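{- Fix a constant $B\ge 1$. An ideal SABT for $n$ keys with total number of accesses $m$ can be built in $O(\min(n\log n, m))$ time, uses $O(n)$ memory, and has depth $O(\log_B m)$.
   Context: A Generic Self-Adjusting Tree (GSAT) with degree function $D$ for a set of integer keys with access counts $ac_i\ge1$ consists of $m=\sum_i ac_i$, an array of $k\le\lceil D(m)\rceil$ representative keys with their access counts, and $k+1$ child subtrees that are GSATs for the keys lying strictly before the first representative, strictly between consecutive representatives, and strictly after the last; every node stores at least one key. $m(T')$ is the total access count of keys in subtree $T'$. A GSAT is ideal if each child $T_j$ of the root satisfies $m(T_j)\le m/(D(m)+1)$ and each child is ideal. An SABT (Self-Adjusting B-Tree) is a GSAT with constant degree function $D(m)=B$. Cost model for construction: given keys sorted with prefix sums of access counts, a node costs $O(B)$ time and memory plus $O(\log n)$ time per representative (each representative chosen by binary search on prefix sums), besides recursive construction of its children.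
   Formalization: For B = 1, where log_B m is undefined, the depth bound is read with base 2 (the base is max(2, B)); the time bound is O(max(1, min(n log n, m))), since n log n = 0 for n = 1 while building one node takes positive time. -}

module Defs where

open import Data.Bool.Base using (if_then_else_)
open import Data.Integer.Base as ℤ using (ℤ)
open import Data.List.Base using (List; []; _∷_; _++_; length; map; take; drop; head)
open import Data.List.Relation.Unary.All using (All)
open import Data.List.Relation.Unary.Linked using (Linked)
open import Data.Maybe.Base using (just)
open import Data.Nat.Base
open import Data.Nat.ListAction using (sum)
open import Data.Product.Base using (_×_; proj₁; proj₂)
open import Data.Sum.Base using (_⊎_)
open import Data.Vec.Base using (Vec; []; _∷_)
import Data.Vec.Relation.Unary.All as VecAll
open import Function.Base using (_on_)
open import Relation.Binary.PropositionalEquality using (_≡_)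

Entry : Set
Entry = ℤ × ℕ

total : List Entry → ℕ
total S = sum (map proj₂ S)

record IsKeySet (S : List Entry) : Set where
  field
    sorted   : Linked (ℤ._<_ on proj₁) S
    positive : All (λ e → 1 ≤ proj₂ e) S

-- `nil` is the (absent) subtree for an empty set of keys; it is not a node.
data Tree : Set where
  nil  : Tree
  node : (m : ℕ) {k : ℕ} (reps : Vec Entry k) (children : Vec Tree (suc k)) → Tree

-- The stored value of m; by `IsGSAT` it is the total access count of the
-- keys in the subtree.
mass : Tree → ℕ
mass nil          = 0
mass (node m _ _) = m

module _ (D : ℕ → ℕ) where

  -- `IsGSAT D S T` : T is a GSAT with degree function D for the sorted list S.
  -- As S is strictly sorted, cutting S at the representatives yields exactly the
  -- keys strictly before, strictly between and strictly after them.
  mutual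
    data IsGSAT : List Entry → Tree → Set where
      nil  : IsGSAT [] nil
      node : ∀ {S m k} {reps : Vec Entry k} {children : Vec Tree (suc k)} →
             m ≡ total S → 1 ≤ k → k ≤ D m →
             AreSubtrees S reps children →
             IsGSAT S (node m reps children)

    data AreSubtrees : List Entry → ∀ {k} → Vec Entry k → Vec Tree (suc k) → Set where
      last : ∀ {S T} → IsGSAT S T → AreSubtrees S [] (T ∷ [])
      cut  : ∀ {S L r R T k} {reps : Vec Entry k} {children : Vec Tree (suc k)} →
             S ≡ L ++ r ∷ R → IsGSAT L T → AreSubtrees R reps children →
             AreSubtrees S (r ∷ reps) (T ∷ children)

  -- The first condition is m(T_j) ≤ m / (D(m) + 1) with the denominator cleared.
  data Ideal : Tree → Set where
    nil  : Ideal nil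
    node : ∀ {m k} {reps : Vec Entry k} {children : Vec Tree (suc k)} →
           VecAll.All (λ T → mass T * (D m + 1) ≤ m) children →
           VecAll.All Ideal children →
           Ideal (node m reps children)

IsSABT : ℕ → List Entry → Tree → Set
IsSABT B = IsGSAT (λ _ → B)

IdealSABT : ℕ → List Entry → Tree → Set
IdealSABT B S T = IsSABT B S T × Ideal (λ _ → B) T

mutual
  levels : Tree → ℕ
  levels nil                 = 0
  levels (node _ _ children) = suc (maxLevels children)

  maxLevels : ∀ {k} → Vec Tree k → ℕ
  maxLevels []       = 0
  maxLevels (T ∷ Ts) = levels T ⊔ maxLevels Ts

-- The number of edges on a longest path from the root.
depth : Tree → ℕ
depth T = pred (levels T)

mutual
  nodes : Tree → ℕ
  nodes nil                 = 0
  nodes (node _ _ children) = suc (sumNodes children)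

  sumNodes : ∀ {k} → Vec Tree k → ℕ
  sumNodes []       = 0
  sumNodes (T ∷ Ts) = nodes T + sumNodes Ts

-- For b ≥ 2, the largest l with b ^ l ≤ m (and 0 for m = 0): such an l is at
-- most m, so it is searched for downwards from m.
⌊log[_]_⌋ : ℕ → ℕ → ℕ
⌊log[ b ] m ⌋ = go m
  where
  go : ℕ → ℕ
  go zero    = 0
  go (suc l) = if b ^ suc l ≤ᵇ m then suc l else go l

-- The constants hidden in the O's of the cost model: a node takes
-- nodeTime * B time and nodeMemory * B memory, and every probe of the array of
-- prefix sums during a binary search takes probeTime.
record Costs : Set where
  field
    nodeTime probeTime nodeMemory : ℕ

memory : Costs → ℕ → Tree → ℕ
memory c B T = nodes T * (Costs.nodeMemory c * B)

-- The construction on the sorted input S with its prefix sums, as a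
-- deterministic big-step cost semantics.  Its only parameter is the rule θ: in a
-- node of total access count m, the i-th representative (1 ≤ i ≤ B) is the first
-- remaining key at which the prefix sum, counted from the start of the node's
-- range, reaches θ m i.
module Construction (c : Costs) (B : ℕ) (θ : ℕ → ℕ → ℕ) (S : List Entry) where
  open Costs c

  prefix : ℕ → ℕ
  prefix i = total (take i S)

  -- `Search x lo hi j p` : binary search with p probes finds j, the first index
  -- in [lo , hi) with x ≤ prefix (suc j) (and j = hi if there is none).
  data Search (x : ℕ) : (lo hi j p : ℕ) → Set where
    done  : ∀ {j} → Search x j j j 0
    left  : ∀ {lo hi j p} → lo < hi → x ≤ prefix (suc ⌊ lo + hi /2⌋) →
            Search x lo ⌊ lo + hi /2⌋ j p → Search x lo hi j (suc p)
    right : ∀ {lo hi j p} → lo < hi → prefix (suc ⌊ lo + hi /2⌋) < x →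
            Search x (suc ⌊ lo + hi /2⌋) hi j p → Search x lo hi j (suc p)

  mutual
    -- `Builds lo hi T t` : the construction for the keys with (0-based) indices
    -- in [lo , hi) returns T after time t.
    data Builds : (lo hi : ℕ) → Tree → (t : ℕ) → Set where
      nil  : ∀ {i} → Builds i i nil 0
      node : ∀ {lo hi t k} {reps : Vec Entry k} {children : Vec Tree (suc k)} →
             lo < hi →
             Fills (prefix lo) (prefix hi ∸ prefix lo) 1 lo hi reps children t →
             Builds lo hi (node (prefix hi ∸ prefix lo) reps children)
                    (nodeTime * B + t)

    -- `Fills base m i lo hi reps children t` : in a node of total m whose range
    -- has `base` accesses before it, the representatives from the i-th on and
    -- their subtrees are produced from the remaining keys [lo , hi) in time t.
    data Fills (base m : ℕ) : (i lo hi : ℕ) → ∀ {k} → Vec Entry k → Vec Tree (suc k) → (t : ℕ) → Set where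
      stop : ∀ {i lo hi T t} → B < i ⊎ lo ≡ hi → Builds lo hi T t →
             Fills base m i lo hi [] (T ∷ []) t
      pick : ∀ {i lo hi j p r T t₁ t₂ k} {reps : Vec Entry k} {children : Vec Tree (suc k)} →
             i ≤ B → lo < hi →
             Search (base + θ m i) lo hi j p → j < hi → head (drop j S) ≡ just r →
             Builds lo j T t₁ →
             Fills base m (suc i) (suc j) hi reps children t₂ →
             Fills base m i lo hi (r ∷ reps) (T ∷ children) (probeTime * p + t₁ + t₂)

-- `Built c B θ S T t` : the construction with rule θ turns S into T in time t.
Built : Costs → ℕ → (ℕ → ℕ → ℕ) → List Entry → Tree → ℕ → Set
Built c B θ S T t = Construction.Builds c B θ S 0 (length S) T t

{-# OPTIONS --safe #-}

-- The i-th representative of a node of total m is the key at which the prefix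
-- sum reaches ⌈ i m / (B + 1) ⌉, so consecutive representatives enclose at most
-- m / (B + 1) accesses.  Every node stores a key, which bounds the memory, and
-- each step down divides the total by at least B + 1, which bounds the depth.
--
-- For the time bound n log n, each representative pays for its own search and
-- for its node.  For the bound m, all searches in a node of total below
-- 2 ^ (l + 1) take at most l + 1 probes, and nodes with totals in the same
-- interval [2 ^ l , 2 ^ (l + 1)) have disjoint key ranges, so there are at most
-- m / 2 ^ l of them; and Σ (l + 1) / 2 ^ l converges.
module Submission where

open import Defs
open import Data.Bool.Base using (if_then_else_; true; false; T)
open import Data.Empty using (⊥-elim)
open import Data.List.Base using (List; []; _∷_; _++_; length; take; drop; head)
open import Data.List.Properties using (length-++; length-take; length-drop; take-all)
open import Data.List.Relation.Unary.All as All using (All)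
import Data.List.Relation.Unary.All.Properties as All
open import Data.Maybe.Base using (just)
open import Data.Nat.Base
open import Data.Nat.DivMod using (_/_; _%_; m≡m%n+[m/n]*n; m%n<n; m/n*n≤m)
open import Data.Nat.Logarithm using (⌊log₂_⌋; ⌊log₂⌋-mono-≤; ⌊log₂[2^n]⌋≡n)
open import Data.Nat.Properties
open import Data.Nat.Tactic.RingSolver using (solve; solve-∀)
open import Data.Product.Base using (Σ-syntax; ∃-syntax; _×_; _,_; proj₁; proj₂)
open import Data.Sum.Base using (_⊎_; inj₁; inj₂)
open import Data.Vec.Base using (Vec)
import Data.Vec.Relation.Unary.All as VecAll
open import Relation.Binary.PropositionalEquality using (_≡_; refl; sym; trans; cong; subst)
open import Relation.Nullary using (yes; no; contradiction)

open ≤-Reasoning hiding (stop)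

-- Logarithms and halving

n<2^n : ∀ n → n < 2 ^ n
n<2^n zero    = z<s
n<2^n (suc n) = begin-strict
  suc n          <⟨ s<s (n<2^n n) ⟩
  1 + 2 ^ n      ≤⟨ +-monoˡ-≤ (2 ^ n) (m^n>0 2 n) ⟩
  2 ^ n + 2 ^ n  ≡⟨ cong (2 ^ n +_) (+-identityʳ (2 ^ n)) ⟨
  2 ^ suc n      ∎

n<2^[1+⌊log₂n⌋] : ∀ n → n < 2 ^ suc ⌊log₂ n ⌋
n<2^[1+⌊log₂n⌋] n with n <? 2 ^ suc ⌊log₂ n ⌋
... | yes n<2^ = n<2^
... | no  n≮2^ = contradiction (begin-strict
  ⌊log₂ n ⌋                  <⟨ n<1+n _ ⟩
  suc ⌊log₂ n ⌋              ≡⟨ ⌊log₂[2^n]⌋≡n _ ⟨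
  ⌊log₂ 2 ^ suc ⌊log₂ n ⌋ ⌋  ≤⟨ ⌊log₂⌋-mono-≤ (≮⇒≥ n≮2^) ⟩
  ⌊log₂ n ⌋                  ∎) (<-irrefl refl)

-- `logSearch` is the local function in the definition of ⌊log[_]_⌋; generalising
-- suc k separates its bound from its counter, so that unification can name it.
mutual
  logSearch : ℕ → ℕ → ℕ → ℕ
  logSearch = _

  logSearch-unfold : ∀ b k → ⌊log[ b ] suc k ⌋ ≡
    (if b ^ suc k ≤ᵇ suc k then suc k else logSearch b (suc k) k)
  logSearch-unfold b k with suc k
  ... | _ = refl

-- The search counts down from `l`, so it meets `d` before anything smaller, and at `d` its test
-- succeeds.
≤-logSearch : ∀ {b m d} l → d ≤ l → b ^ d ≤ m → d ≤ logSearch b m l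
≤-logSearch zero d≤0 _ = d≤0
≤-logSearch {b} {m} {d} (suc l) d≤1+l b^d≤m with b ^ suc l ≤ᵇ m in eq
... | true  = d≤1+l
... | false with m≤n⇒m<n∨m≡n d≤1+l
...   | inj₁ d<1+l = ≤-logSearch l (s≤s⁻¹ d<1+l) b^d≤m
...   | inj₂ refl  = ⊥-elim (subst T eq (≤⇒≤ᵇ b^d≤m))

-- The search starts at `m`, which is high enough: `2 ≤ b` gives `d < 2 ^ d ≤ b ^ d ≤ m`.
b^d≤m⇒d≤⌊log[b]m⌋ : ∀ {b m d} → 2 ≤ b → b ^ d ≤ m → d ≤ ⌊log[ b ] m ⌋
b^d≤m⇒d≤⌊log[b]m⌋ {b} {m} {d} 2≤b b^d≤m = ≤-logSearch m d≤m b^d≤m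
  where
  d≤m : d ≤ m
  d≤m = begin
    d      ≤⟨ <⇒≤ (n<2^n d) ⟩
    2 ^ d  ≤⟨ ^-monoˡ-≤ d 2≤b ⟩
    b ^ d  ≤⟨ b^d≤m ⟩
    m      ∎

2*⌊n/2⌋≤n : ∀ n → 2 * ⌊ n /2⌋ ≤ n
2*⌊n/2⌋≤n zero          = z≤n
2*⌊n/2⌋≤n (suc zero)    = z≤n
2*⌊n/2⌋≤n (suc (suc n)) = begin
  2 * suc ⌊ n /2⌋    ≡⟨ *-suc 2 ⌊ n /2⌋ ⟩
  2 + 2 * ⌊ n /2⌋    ≤⟨ +-monoʳ-≤ 2 (2*⌊n/2⌋≤n n) ⟩
  2 + n              ∎

n≤1+2*⌊n/2⌋ : ∀ n → n ≤ suc (2 * ⌊ n /2⌋)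
n≤1+2*⌊n/2⌋ zero          = z≤n
n≤1+2*⌊n/2⌋ (suc zero)    = ≤-refl
n≤1+2*⌊n/2⌋ (suc (suc n)) = begin
  2 + n                    ≤⟨ +-monoʳ-≤ 2 (n≤1+2*⌊n/2⌋ n) ⟩
  3 + 2 * ⌊ n /2⌋          ≡⟨ cong suc (*-suc 2 ⌊ n /2⌋) ⟨
  suc (2 * suc ⌊ n /2⌋)    ∎

m≤⌊m+n/2⌋ : ∀ {m n} → m ≤ n → m ≤ ⌊ m + n /2⌋
m≤⌊m+n/2⌋ {m} {n} m≤n = begin
  m            ≡⟨ n≡⌊n+n/2⌋ m ⟩
  ⌊ m + m /2⌋  ≤⟨ ⌊n/2⌋-mono (+-monoʳ-≤ m m≤n) ⟩
  ⌊ m + n /2⌋  ∎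

⌊m+n/2⌋<n : ∀ {m n} → m < n → ⌊ m + n /2⌋ < n
⌊m+n/2⌋<n {m} {n} m<n = *-cancelˡ-< 2 _ _ (begin-strict
  2 * ⌊ m + n /2⌋  ≤⟨ 2*⌊n/2⌋≤n (m + n) ⟩
  m + n            <⟨ +-monoˡ-< n m<n ⟩
  n + n            ≡⟨ cong (n +_) (+-identityʳ n) ⟨
  2 * n            ∎)

-- For a binary search that goes left: a window of fewer than `2 * o` keys leaves fewer than `o`.
⌊m+n/2⌋<m+o : ∀ {m n o} → n < m + 2 * o → ⌊ m + n /2⌋ < m + o
⌊m+n/2⌋<m+o {m} {n} {o} n<m+2o = *-cancelˡ-< 2 _ _ (begin-strict
  2 * ⌊ m + n /2⌋    ≤⟨ 2*⌊n/2⌋≤n (m + n) ⟩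
  m + n              <⟨ +-monoʳ-< m n<m+2o ⟩
  m + (m + 2 * o)    ≡⟨ solve (m ∷ o ∷ []) ⟩
  2 * (m + o)        ∎)

-- The same for a search that goes right; discarding the probed key makes up for the rounding of the
-- midpoint.
n<1+⌊m+n/2⌋+o : ∀ {m n o} → n < m + 2 * o → n < suc ⌊ m + n /2⌋ + o
n<1+⌊m+n/2⌋+o {m} {n} {o} n<m+2o =
  *-cancelˡ-< 2 _ _ (+-cancelˡ-< m _ _ (begin-strict
    m + 2 * n                        ≡⟨ solve (m ∷ n ∷ []) ⟩
    (m + n) + n                      <⟨ +-mono-≤-< (n≤1+2*⌊n/2⌋ (m + n)) n<m+2o ⟩
    suc (2 * h) + (m + 2 * o)        ≤⟨ n≤1+n _ ⟩
    2 + 2 * h + (m + 2 * o)          ≡⟨ rearrange h ⟩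
    m + 2 * (suc h + o)              ∎))
  where
  h = ⌊ m + n /2⌋
  rearrange : ∀ h → 2 + 2 * h + (m + 2 * o) ≡ m + 2 * (suc h + o)
  rearrange h = solve (h ∷ m ∷ o ∷ [])

-- Segments of a list

-- Supplies the decomposition of a segment at a representative that `cut` asks for.
drop-take-split : ∀ {A : Set} (xs : List A) {lo j hi r} → lo ≤ j → j < hi →
  head (drop j xs) ≡ just r →
  drop lo (take hi xs) ≡ drop lo (take j xs) ++ r ∷ drop (suc j) (take hi xs)
drop-take-split []       {j = zero}  _ _ ()
drop-take-split []       {j = suc _} _ _ ()
drop-take-split (x ∷ xs) z≤n       (s≤s {zero}  _)   refl = refl
drop-take-split (x ∷ xs) z≤n       (s≤s {suc j} j<h) eq   =
  cong (x ∷_) (drop-take-split xs z≤n j<h eq)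
drop-take-split (x ∷ xs) (s≤s l≤j) (s≤s j<h)         eq   =
  drop-take-split xs l≤j j<h eq

head-drop : ∀ {A : Set} (xs : List A) {j} → j < length xs → ∃[ r ] head (drop j xs) ≡ just r
head-drop (x ∷ xs) {zero}  _         = x , refl
head-drop (x ∷ xs) {suc j} (s≤s j<n) = head-drop xs j<n

drop-take-empty : ∀ {A : Set} (xs : List A) i → drop i (take i xs) ≡ []
drop-take-empty []       zero    = refl
drop-take-empty []       (suc i) = refl
drop-take-empty (x ∷ xs) zero    = refl
drop-take-empty (x ∷ xs) (suc i) = drop-take-empty xs i

total-drop-take : ∀ xs {lo hi} → lo ≤ hi →
  total (take lo xs) + total (drop lo (take hi xs)) ≡ total (take hi xs)
total-drop-take xs       z≤n             = refl
total-drop-take []       (s≤s _)         = refl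
total-drop-take (x ∷ xs) (s≤s l≤h)       =
  trans (+-assoc (proj₂ x) _ _) (cong (proj₂ x +_) (total-drop-take xs l≤h))

Positive : List Entry → Set
Positive = All (λ e → 1 ≤ proj₂ e)

length≤total : ∀ {xs} → Positive xs → length xs ≤ total xs
length≤total All.[]         = z≤n
length≤total (p All.∷ ps) = +-mono-≤ p (length≤total ps)

-- Memory and depth of ideal trees

module _ {D : ℕ → ℕ} where
  mutual
    -- Representatives at different places of the tree are different entries of the list, and
    -- `1 ≤ k` lets each node be charged to one of its own.
    nodes≤length : ∀ {S T} → IsGSAT D S T → nodes T ≤ length S
    nodes≤length nil                    = z≤n
    nodes≤length (node {S} {k = k} {children = children} _ 1≤k _ subs) = begin
      1 + sumNodes children  ≤⟨ +-monoˡ-≤ _ 1≤k ⟩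
      k + sumNodes children  ≤⟨ k+sumNodes≤length subs ⟩
      length S               ∎

    k+sumNodes≤length : ∀ {S k} {reps : Vec Entry k} {children} →
      AreSubtrees D S reps children → k + sumNodes children ≤ length S
    k+sumNodes≤length (last {T = T} g) rewrite +-identityʳ (nodes T) = nodes≤length g
    k+sumNodes≤length (cut {L = L} {r} {R} {T} {k} {children = children} refl g subs) = begin
      suc k + (nodes T + sumNodes children)  ≡⟨ rearrange k (nodes T) (sumNodes children) ⟩
      nodes T + suc (k + sumNodes children)  ≤⟨ +-mono-≤ (nodes≤length g) (s≤s (k+sumNodes≤length subs)) ⟩
      length L + suc (length R)              ≡⟨ length-++ L ⟨
      length (L ++ r ∷ R)                    ∎
      where
      rearrange : ∀ k x y → suc k + (x + y) ≡ x + suc (k + y)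
      rearrange = solve-∀

module _ {B : ℕ} where
  mutual
    -- Some node lies `d` edges below the root. It stores a key, so its mass is at least 1, and
    -- ideality multiplies the mass by at least `B + 1` on each edge upwards.
    [B+1]^d≤mass : ∀ {S T d} → Positive S → IdealSABT B S T → d < levels T → (B + 1) ^ d ≤ mass T
    [B+1]^d≤mass {d = zero} pos (node {S = S} refl 1≤k _ subs , _) _ =
      ≤-trans (nonempty 1≤k subs) (length≤total pos)
      where
      nonempty : ∀ {S k} {reps : Vec Entry k} {children} → 1 ≤ k →
        AreSubtrees (λ _ → B) S reps children → 1 ≤ length S
      nonempty {S} {k} {_} {children} 1≤k subs =
        ≤-trans 1≤k (≤-trans (m≤m+n k (sumNodes children)) (k+sumNodes≤length subs))
    [B+1]^d≤mass {d = suc d} pos (node _ _ _ subs , node small ideal) (s≤s d<max) =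
      [B+1]^[1+d]≤m pos subs small ideal d<max

    [B+1]^[1+d]≤m : ∀ {S m d k} {reps : Vec Entry k} {children} → Positive S →
      AreSubtrees (λ _ → B) S reps children →
      VecAll.All (λ T → mass T * (B + 1) ≤ m) children →
      VecAll.All (Ideal (λ _ → B)) children →
      d < maxLevels children → (B + 1) ^ suc d ≤ m
    [B+1]^[1+d]≤m pos (last {T = T} g) (s VecAll.∷ VecAll.[]) (i VecAll.∷ VecAll.[]) d<max
      rewrite ⊔-identityʳ (levels T) = child-bound pos g s i d<max
    [B+1]^[1+d]≤m pos (cut {L = L} {T = T} {children = children} refl g subs) (s VecAll.∷ ss) (i VecAll.∷ is) d<max
      -- The deep child is the first one or lies among the rest, whichever attains the maximum.
      with ⊔-sel (levels T) (maxLevels children)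
    ... | inj₁ eq = child-bound (All.++⁻ˡ L pos) g s i (subst (_ <_) eq d<max)
    ... | inj₂ eq with _ All.∷ pos′ ← All.++⁻ʳ L pos =
      [B+1]^[1+d]≤m pos′ subs ss is (subst (_ <_) eq d<max)

    child-bound : ∀ {S T m d} → Positive S → IsSABT B S T → mass T * (B + 1) ≤ m →
      Ideal (λ _ → B) T → d < levels T → (B + 1) ^ suc d ≤ m
    child-bound {T = T} {m} {d} pos g s i d<levels = begin
      (B + 1) * (B + 1) ^ d  ≡⟨ *-comm (B + 1) _ ⟩
      (B + 1) ^ d * (B + 1)  ≤⟨ *-monoˡ-≤ (B + 1) ([B+1]^d≤mass pos (g , i) d<levels) ⟩
      mass T * (B + 1)       ≤⟨ s ⟩
      m                      ∎

depth≤log : ∀ {B S T} → 1 ≤ B → Positive S → IdealSABT B S T → depth T ≤ ⌊log[ 2 ⊔ B ] total S ⌋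
depth≤log _ _ (nil , _) = z≤n
depth≤log {B} {T = T@(node m _ children)} 1≤B pos ideal@(node refl _ _ _ , _) =
  b^d≤m⇒d≤⌊log[b]m⌋ (m≤m⊔n 2 B) (begin
    -- `1 ≤ B` makes `B + 1` at least as large as both 2 and `B`.
    (2 ⊔ B) ^ depth T  ≤⟨ ^-monoˡ-≤ (depth T) (⊔-lub (+-monoˡ-≤ 1 1≤B) (m≤m+n B 1)) ⟩
    (B + 1) ^ depth T  ≤⟨ [B+1]^d≤mass pos ideal ≤-refl ⟩
    m                  ∎)

-- Arithmetic of the thresholds and of the weights

-- ⌈ i m / (B + 1) ⌉
threshold : ℕ → ℕ → ℕ → ℕ
threshold B m i = (i * m + B) / suc B

module _ (B m i : ℕ) where
  threshold-upper : threshold B m i * (B + 1) ≤ i * m + B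
  threshold-upper rewrite +-comm B 1 = m/n*n≤m (i * m + B) (suc B)

  threshold-lower : i * m ≤ threshold B m i * (B + 1)
  threshold-lower rewrite +-comm B 1 = +-cancelʳ-≤ B _ _ (begin
    i * m + B                                     ≡⟨ m≡m%n+[m/n]*n (i * m + B) (suc B) ⟩
    (i * m + B) % suc B + threshold B m i * suc B  ≤⟨ +-monoˡ-≤ _ (s≤s⁻¹ (m%n<n (i * m + B) (suc B))) ⟩
    B + threshold B m i * suc B                   ≡⟨ +-comm B _ ⟩
    threshold B m i * suc B + B                   ∎)

  -- Rounding up does not overshoot the total, since `B * m + B < suc m * (B + 1)`. Hence every
  -- search for a representative succeeds.
  threshold≤m : i ≤ B → threshold B m i ≤ m
  threshold≤m i≤B = s≤s⁻¹ (*-cancelʳ-< (B + 1) _ _ (begin-strict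
    threshold B m i * (B + 1)  ≤⟨ threshold-upper ⟩
    i * m + B                  ≤⟨ +-monoˡ-≤ B (*-monoˡ-≤ m i≤B) ⟩
    B * m + B                  <⟨ m<m+n _ z<s ⟩
    B * m + B + suc m          ≡⟨ solve (B ∷ m ∷ []) ⟩
    suc m * (B + 1)            ∎))

-- weight L / 2 ^ L = Σ_{l < L} (l + 1) / 2 ^ l, which bounds, up to a constant, the
-- time per access in a subtree of total below 2 ^ L.
weight : ℕ → ℕ
weight zero    = 0
weight (suc L) = 2 * weight L + 2 * suc L

-- The partial sum is `4 - 2 * (L + 2) / 2 ^ L`, here with the denominator cleared and the negative
-- term moved across.
weight-closed : ∀ L → weight L + 2 * (L + 2) ≡ 4 * 2 ^ L
weight-closed zero    = refl
weight-closed (suc L) = begin-equality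
  2 * weight L + 2 * suc L + 2 * (suc L + 2)  ≡⟨ rearrange (weight L) L ⟩
  2 * (weight L + 2 * (L + 2))                ≡⟨ cong (2 *_) (weight-closed L) ⟩
  2 * (4 * 2 ^ L)                             ≡⟨ swap (2 ^ L) ⟩
  4 * (2 * 2 ^ L)                             ∎
  where
  rearrange : ∀ w L → 2 * w + 2 * suc L + 2 * (suc L + 2) ≡ 2 * (w + 2 * (L + 2))
  rearrange = solve-∀
  swap : ∀ x → 2 * (4 * x) ≡ 4 * (2 * x)
  swap = solve-∀

weight≤ : ∀ L → weight L ≤ 4 * 2 ^ L
weight≤ L = subst (weight L ≤_) (weight-closed L) (m≤m+n _ _)

-- Binary search and runs of the construction under an arbitrary rule

module Runs (c : Costs) (B : ℕ) (θ : ℕ → ℕ → ℕ) (S : List Entry) where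
  open Construction c B θ S
  open Costs c

  segment : ℕ → ℕ → List Entry
  segment lo hi = drop lo (take hi S)

  prefix-split : ∀ {lo hi} → lo ≤ hi → prefix lo + total (segment lo hi) ≡ prefix hi
  prefix-split = total-drop-take S

  prefix-mono : ∀ {lo hi} → lo ≤ hi → prefix lo ≤ prefix hi
  prefix-mono {lo} lo≤hi = subst (prefix lo ≤_) (prefix-split lo≤hi) (m≤m+n _ _)

  total-segment : ∀ {lo hi} → lo ≤ hi → prefix hi ∸ prefix lo ≡ total (segment lo hi)
  total-segment {lo} lo≤hi = trans (cong (_∸ prefix lo) (sym (prefix-split lo≤hi))) (m+n∸m≡n (prefix lo) _)

  search-≥ : ∀ {x lo hi j p} → Search x lo hi j p → lo ≤ j
  search-≥ done             = ≤-refl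
  search-≥ (left  _ _ s)    = search-≥ s
  search-≥ (right l<h _ s)  = ≤-trans (m≤⌊m+n/2⌋ (<⇒≤ l<h)) (<⇒≤ (search-≥ s))

  search-≤ : ∀ {x lo hi j p} → Search x lo hi j p → j ≤ hi
  search-≤ done            = ≤-refl
  search-≤ (left l<h _ s)  = ≤-trans (search-≤ s) (<⇒≤ (⌊m+n/2⌋<n l<h))
  search-≤ (right _ _ s)   = search-≤ s

  -- The lower end moves only past a probed key whose prefix sum is below `x`. If it never moves,
  -- the subtree to the left of the found key is empty.
  search-below : ∀ {x lo hi j p} → Search x lo hi j p → j ≡ lo ⊎ prefix j < x
  search-below done           = inj₁ refl
  search-below (left _ _ s)   = search-below s
  search-below (right _ b s) with search-below s
  ... | inj₁ refl = inj₂ b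
  ... | inj₂ b′   = inj₂ b′

  search-reaches : ∀ {x lo hi j p} → Search x lo hi j p → j ≡ hi ⊎ x ≤ prefix (suc j)
  search-reaches done          = inj₁ refl
  search-reaches (left _ a s) with search-reaches s
  ... | inj₁ refl = inj₂ a
  ... | inj₂ a′   = inj₂ a′
  search-reaches (right _ _ s) = search-reaches s

  -- Each probe takes a window of fewer than `2 ^ q` keys to one of fewer than `2 ^ (q - 1)`; at
  -- `q = 0` the window is empty.
  search-probes : ∀ {x lo hi j p} q → Search x lo hi j p → hi < lo + 2 ^ q → p ≤ q
  search-probes q       done _ = z≤n
  search-probes {lo = lo} zero (left l<h _ _)  h<l+1 =
    contradiction (≤-trans h<l+1 (≤-reflexive (+-comm lo 1))) (≤⇒≯ l<h)
  search-probes {lo = lo} zero (right l<h _ _) h<l+1 =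
    contradiction (≤-trans h<l+1 (≤-reflexive (+-comm lo 1))) (≤⇒≯ l<h)
  search-probes {lo = lo} (suc q) (left _ _ s)  h< = s≤s (search-probes q s (⌊m+n/2⌋<m+o {lo} h<))
  search-probes {lo = lo} (suc q) (right _ _ s) h< = s≤s (search-probes q s (n<1+⌊m+n/2⌋+o {lo} h<))

  -- `fuel` bounds the length of the window and serves as the measure of the recursion.
  search-total : ∀ x fuel {lo hi} → lo ≤ hi → hi ≤ lo + fuel → ∃[ j ] ∃[ p ] Search x lo hi j p
  search-total x fuel {lo} {hi} lo≤hi hi≤ with m≤n⇒m<n∨m≡n lo≤hi
  ... | inj₂ refl = _ , _ , done
  search-total x zero {lo} {hi} lo≤hi hi≤ | inj₁ l<h =
    contradiction (≤-trans hi≤ (≤-reflexive (+-identityʳ lo))) (<⇒≱ l<h)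
  search-total x (suc fuel) {lo} {hi} lo≤hi hi≤ | inj₁ l<h
    with x ≤? prefix (suc ⌊ lo + hi /2⌋)
  ... | yes a with _ , _ , s ← search-total x fuel (m≤⌊m+n/2⌋ lo≤hi)
                    (s≤s⁻¹ (≤-trans (⌊m+n/2⌋<n l<h) (≤-trans hi≤ (≤-reflexive (+-suc lo fuel)))))
    = _ , _ , left l<h a s
  ... | no ¬a with _ , _ , s ← search-total x fuel (⌊m+n/2⌋<n l<h)
                    (≤-trans hi≤ (≤-trans (≤-reflexive (+-suc lo fuel)) (s≤s (+-monoˡ-≤ fuel (m≤⌊m+n/2⌋ lo≤hi)))))
    = _ , _ , right l<h (≰⇒> ¬a) s

  fills-nonempty : ∀ {base m i lo hi k t} {reps : Vec Entry k} {children} → i ≤ B → lo < hi →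
    Fills base m i lo hi reps children t → 1 ≤ k
  fills-nonempty i≤B _   (stop (inj₁ B<i) _)  = contradiction i≤B (<⇒≱ B<i)
  fills-nonempty _   l<h (stop (inj₂ refl) _) = contradiction l<h (<-irrefl refl)
  fills-nonempty _   _   (pick _ _ _ _ _ _ _) = s≤s z≤n

  -- The indices in use never exceed `B`; a node starts at index 1, so it gets at most `B`
  -- representatives.
  fills-bounded : ∀ {base m i lo hi k t} {reps : Vec Entry k} {children} → i ≤ suc B →
    Fills base m i lo hi reps children t → i + k ≤ suc B
  fills-bounded {i = i} i≤1+B (stop _ _) = ≤-trans (≤-reflexive (+-identityʳ i)) i≤1+B
  fills-bounded {i = i} _ (pick {k = k} i≤B _ _ _ _ _ f) =
    ≤-trans (≤-reflexive (+-suc i k)) (fills-bounded (s≤s i≤B) f)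

  mass-builds : ∀ {lo hi T t} → Builds lo hi T t → mass T ≡ prefix hi ∸ prefix lo
  mass-builds {lo} nil   = sym (n∸n≡0 (prefix lo))
  mass-builds (node _ _) = refl

  -- Runs return SABTs; their time in terms of the number of keys

  module _ (1≤B : 1 ≤ B) where
    mutual
      builds-SABT : ∀ {lo hi T t} → Builds lo hi T t → IsSABT B (segment lo hi) T
      builds-SABT {lo} nil rewrite drop-take-empty S lo = nil
      builds-SABT (node l<h f) =
        node (total-segment (<⇒≤ l<h)) (fills-nonempty 1≤B l<h f) (s≤s⁻¹ (fills-bounded (s≤s z≤n) f))
             (fills-subtrees f)

      fills-subtrees : ∀ {base m i lo hi k t} {reps : Vec Entry k} {children} →
        Fills base m i lo hi reps children t → AreSubtrees (λ _ → B) (segment lo hi) reps children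
      fills-subtrees (stop _ b) = last (builds-SABT b)
      fills-subtrees (pick _ _ s j<h eq b f) =
        cut (drop-take-split S (search-≥ s) j<h eq) (builds-SABT b) (fills-subtrees f)

    -- Every key can pay for one search and one node.  The k * a in `fills-time-keys`
    -- is what the k representatives have left to pay for the node they belong to.
    module _ (q : ℕ) where
      private
        a = nodeTime * B
        X = a + probeTime * q

      mutual
        builds-time-keys : ∀ {lo hi T t} → Builds lo hi T t → hi < lo + 2 ^ q → t + lo * X ≤ hi * X
        builds-time-keys nil _ = ≤-refl
        builds-time-keys {lo} {hi} (node {t = t} {k} l<h f) h< = begin
          a + t + lo * X      ≡⟨ cong (_+ lo * X) (+-comm a t) ⟩
          t + a + lo * X      ≤⟨ +-monoˡ-≤ (lo * X) (+-monoʳ-≤ t (m≤n*m a k {{>-nonZero (fills-nonempty 1≤B l<h f)}})) ⟩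
          t + k * a + lo * X  ≤⟨ fills-time-keys f h< ⟩
          hi * X              ∎

        fills-time-keys : ∀ {base m i lo hi k t} {reps : Vec Entry k} {children} →
          Fills base m i lo hi reps children t → hi < lo + 2 ^ q → t + k * a + lo * X ≤ hi * X
        fills-time-keys {lo = lo} {t = t} (stop _ b) h< rewrite +-identityʳ t = builds-time-keys b h<
        fills-time-keys {lo = lo} {hi} (pick {j = j} {p} {t₁ = t₁} {t₂} {k} _ _ s j<h _ b f) h< =
          combine lo j hi t₁ t₂ k a (probeTime * p) (probeTime * q)
            (*-monoʳ-≤ probeTime (search-probes q s h<))
            (builds-time-keys b (<-trans j<h h<))
            (fills-time-keys f (≤-trans h< (+-monoˡ-≤ (2 ^ q) (m≤n⇒m≤1+n (search-≥ s)))))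
          where
          combine : ∀ lo j hi t₁ t₂ k a u v → u ≤ v → t₁ + lo * (a + v) ≤ j * (a + v) →
            t₂ + k * a + suc j * (a + v) ≤ hi * (a + v) →
            u + t₁ + t₂ + suc k * a + lo * (a + v) ≤ hi * (a + v)
          combine lo j hi t₁ t₂ k a u v u≤v h₁ h₂ = begin
            u + t₁ + t₂ + suc k * a + lo * (a + v)          ≡⟨ solve (lo ∷ t₁ ∷ t₂ ∷ k ∷ a ∷ u ∷ v ∷ []) ⟩
            u + (t₁ + lo * (a + v)) + (t₂ + k * a + a)      ≤⟨ +-monoˡ-≤ _ (+-mono-≤ u≤v h₁) ⟩
            -- The key at index `j` contributes one `a + v`: `v` pays for its search and `a` is kept
            -- for the enclosing node.
            v + j * (a + v) + (t₂ + k * a + a)              ≡⟨ solve (j ∷ t₂ ∷ k ∷ a ∷ v ∷ []) ⟩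
            t₂ + k * a + suc j * (a + v)                    ≤⟨ h₂ ⟩
            hi * (a + v)                                    ∎

  -- Time of runs in terms of the total access count

  module _ (1≤B : 1 ≤ B) (pos : Positive S) where
    private
      K = nodeTime * B + B * probeTime

    keys≤mass : ∀ {lo hi} → lo ≤ hi → hi ≤ length S → hi + prefix lo ≤ lo + prefix hi
    keys≤mass {lo} {hi} lo≤hi hi≤n = begin
      hi + prefix lo                              ≡⟨ cong (_+ prefix lo) (m+[n∸m]≡n lo≤hi) ⟨
      lo + (hi ∸ lo) + prefix lo                  ≡⟨ cong (λ x → lo + x + prefix lo) (sym len) ⟩
      lo + length (segment lo hi) + prefix lo     ≤⟨ +-monoˡ-≤ _ (+-monoʳ-≤ lo (length≤total (All.drop⁺ lo (All.take⁺ hi pos)))) ⟩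
      lo + total (segment lo hi) + prefix lo      ≡⟨ +-assoc lo _ _ ⟩
      lo + (total (segment lo hi) + prefix lo)    ≡⟨ cong (lo +_) (trans (+-comm _ (prefix lo)) (prefix-split lo≤hi)) ⟩
      lo + prefix hi                              ∎
      where
      len : length (segment lo hi) ≡ hi ∸ lo
      len = trans (length-drop lo (take hi S)) (cong (_∸ lo) (trans (length-take hi S) (m≤n⇒m⊓n≡m hi≤n)))

    -- Every key has at least one access, so fewer than `N` accesses mean fewer than `N` keys. This
    -- turns a bound on the total into a bound on the probes.
    range-bound : ∀ {lo hi N} → lo ≤ hi → hi ≤ length S → prefix hi < prefix lo + N → hi < lo + N
    range-bound {lo} {hi} {N} lo≤hi hi≤n P< = +-cancelʳ-< (prefix lo) _ _ (begin-strict
      hi + prefix lo        ≤⟨ keys≤mass lo≤hi hi≤n ⟩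
      lo + prefix hi        <⟨ +-monoʳ-< lo P< ⟩
      lo + (prefix lo + N)  ≡⟨ cong (lo +_) (+-comm (prefix lo) N) ⟩
      lo + (N + prefix lo)  ≡⟨ +-assoc lo N _ ⟨
      lo + N + prefix lo    ∎)

    mass-bound : ∀ {lo hi T t N} → Builds lo hi T t → mass T < N → prefix hi < prefix lo + N
    mass-bound {lo} {hi} {T} {N = N} b mass<N = begin-strict
      prefix hi                            ≤⟨ m≤n+m∸n (prefix hi) (prefix lo) ⟩
      prefix lo + (prefix hi ∸ prefix lo)  ≡⟨ cong (prefix lo +_) (sym (mass-builds b)) ⟩
      prefix lo + mass T                   <⟨ +-monoʳ-< (prefix lo) mass<N ⟩
      prefix lo + N                        ∎

    -- As `2 ≤ B + 1`, ideality puts every child at least one power of two below its parent.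
    halve : ∀ {x m N} → x * (B + 1) ≤ m → m < 2 * N → x < N
    halve {x} {m} {N} xB≤m m<2N = *-cancelˡ-< 2 _ _ (begin-strict
      2 * x        ≡⟨ *-comm 2 x ⟩
      x * 2        ≤⟨ *-monoʳ-≤ x (+-monoˡ-≤ 1 1≤B) ⟩
      x * (B + 1)  ≤⟨ xB≤m ⟩
      m            <⟨ m<2N ⟩
      2 * N        ∎)

    mutual
      -- Induction on the scale `L`. A total already below `2 ^ L` is handled by the bound for `L`.
      -- Otherwise the node has at least `2 ^ L` accesses, which pay for its own cost of at most
      -- `K * suc L`, and its children are all below `2 ^ L`.
      builds-time-mass : ∀ L {lo hi T t} → Builds lo hi T t → Ideal (λ _ → B) T → hi ≤ length S →
        prefix hi < prefix lo + 2 ^ L →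
        t * 2 ^ L + prefix lo * (K * weight L) ≤ prefix hi * (K * weight L)
      builds-time-mass L nil _ _ _ = ≤-refl
      -- A total below 1 contradicts a nonempty range.
      builds-time-mass zero {lo} {hi} (node l<h _) _ hi≤n P< =
        contradiction l<h (≤⇒≯ (s≤s⁻¹ (≤-trans (range-bound (<⇒≤ l<h) hi≤n P<) (≤-reflexive (+-comm lo 1)))))
      builds-time-mass (suc L) {lo} {hi} b@(node {t = t} {k} l<h f) ideal@(node small ideals) hi≤n P<
        with prefix hi <? prefix lo + 2 ^ L
      ... | yes P<′ = double (nodeTime * B + t) (prefix lo) (prefix hi) (2 ^ L) L K (weight L)
        (prefix-mono (<⇒≤ l<h)) (builds-time-mass L b ideal hi≤n P<′)
        where
        double : ∀ t x y N L K w → x ≤ y → t * N + x * (K * w) ≤ y * (K * w) →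
          t * (2 * N) + x * (K * (2 * w + 2 * suc L)) ≤ y * (K * (2 * w + 2 * suc L))
        double t x y N L K w x≤y h = begin
          t * (2 * N) + x * (K * (2 * w + 2 * suc L))        ≡⟨ solve (t ∷ x ∷ N ∷ L ∷ K ∷ w ∷ []) ⟩
          2 * (t * N + x * (K * w)) + x * (K * (2 * suc L))  ≤⟨ +-mono-≤ (*-monoʳ-≤ 2 h) (*-monoˡ-≤ (K * (2 * suc L)) x≤y) ⟩
          2 * (y * (K * w)) + y * (K * (2 * suc L))          ≡⟨ solve (y ∷ L ∷ K ∷ w ∷ []) ⟩
          y * (K * (2 * w + 2 * suc L))                      ∎
      ... | no P≮ =
        combine t (prefix lo) (prefix hi) (2 ^ L) L (nodeTime * B) B probeTime k (weight L)
          (s≤s⁻¹ (fills-bounded (s≤s z≤n) f)) (≮⇒≥ P≮)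
          (fills-time-mass L f (VecAll.map (λ s → halve s m<) small) ideals hi≤n
            (range-bound (<⇒≤ l<h) hi≤n P<))
        where
        m< : prefix hi ∸ prefix lo < 2 ^ suc L
        m< = m<n+o⇒m∸n<o (prefix hi) (prefix lo) {{m^n≢0 2 (suc L)}} P<

        combine : ∀ t x y N L a B s k w → k ≤ B → x + N ≤ y →
          t * N + x * ((a + B * s) * w) ≤ y * ((a + B * s) * w) + k * (s * suc L * N) →
          (a + t) * (2 * N) + x * ((a + B * s) * (2 * w + 2 * suc L)) ≤ y * ((a + B * s) * (2 * w + 2 * suc L))
        combine t x y N L a B s k w k≤B x+N≤y h = begin
          (a + t) * (2 * N) + x * ((a + B * s) * (2 * w + 2 * suc L))
            ≡⟨ solve (t ∷ x ∷ N ∷ L ∷ a ∷ B ∷ s ∷ w ∷ []) ⟩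
          2 * (t * N + x * ((a + B * s) * w)) + (2 * (a * N) + x * ((a + B * s) * (2 * suc L)))
            ≤⟨ +-monoˡ-≤ _ (*-monoʳ-≤ 2 (≤-trans h (+-monoʳ-≤ _ (*-monoˡ-≤ _ k≤B)))) ⟩
          2 * (y * ((a + B * s) * w) + B * (s * suc L * N)) + (2 * (a * N) + x * ((a + B * s) * (2 * suc L)))
            -- The budget `K * suc L` contains `a` `suc L` times, but the node spends it only once;
            -- this is the surplus.
            ≤⟨ m≤m+n _ (2 * (a * N * L)) ⟩
          2 * (y * ((a + B * s) * w) + B * (s * suc L * N)) + (2 * (a * N) + x * ((a + B * s) * (2 * suc L))) + 2 * (a * N * L)
            ≡⟨ solve (x ∷ y ∷ N ∷ L ∷ a ∷ B ∷ s ∷ w ∷ []) ⟩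
          2 * (y * ((a + B * s) * w)) + (x + N) * ((a + B * s) * (2 * suc L))
            ≤⟨ +-monoʳ-≤ _ (*-monoˡ-≤ _ x+N≤y) ⟩
          2 * (y * ((a + B * s) * w)) + y * ((a + B * s) * (2 * suc L))
            ≡⟨ solve (y ∷ L ∷ a ∷ B ∷ s ∷ w ∷ []) ⟩
          y * ((a + B * s) * (2 * w + 2 * suc L))
            ∎

      -- The last term collects the `k` searches of at most `suc L` probes each. They are kept apart
      -- from the cost of the children because the node as a whole pays for them.
      fills-time-mass : ∀ L {base m i lo hi k t} {reps : Vec Entry k} {children} →
        Fills base m i lo hi reps children t →
        VecAll.All (λ T → mass T < 2 ^ L) children → VecAll.All (Ideal (λ _ → B)) children →
        hi ≤ length S → hi < lo + 2 ^ suc L →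
        t * 2 ^ L + prefix lo * (K * weight L) ≤ prefix hi * (K * weight L) + k * (probeTime * suc L * 2 ^ L)
      fills-time-mass L {lo = lo} {hi} (stop _ b) (s VecAll.∷ VecAll.[]) (i VecAll.∷ VecAll.[]) hi≤n _
        rewrite +-identityʳ (prefix hi * (K * weight L)) = builds-time-mass L b i hi≤n (mass-bound b s)
      fills-time-mass L {lo = lo} {hi} (pick {j = j} {p} {t₁ = t₁} {t₂} {k} _ _ sr j<h _ b f) (s VecAll.∷ ss) (i VecAll.∷ is) hi≤n h< =
        combine (prefix lo) (prefix j) (prefix (suc j)) (prefix hi) t₁ t₂ k (2 ^ L) (K * weight L) (suc L) probeTime p
          (search-probes (suc L) sr h<) (prefix-mono (n≤1+n j))
          (builds-time-mass L b i (≤-trans (<⇒≤ j<h) hi≤n) (mass-bound b s))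
          (fills-time-mass L f ss is hi≤n (≤-trans h< (+-monoˡ-≤ (2 ^ suc L) (m≤n⇒m≤1+n (search-≥ sr)))))
        where
        combine : ∀ x y y′ z t₁ t₂ k N Y q s p → p ≤ q → y ≤ y′ → t₁ * N + x * Y ≤ y * Y →
          t₂ * N + y′ * Y ≤ z * Y + k * (s * q * N) →
          (s * p + t₁ + t₂) * N + x * Y ≤ z * Y + suc k * (s * q * N)
        combine x y y′ z t₁ t₂ k N Y q s p p≤q y≤y′ h₁ h₂ = begin
          (s * p + t₁ + t₂) * N + x * Y            ≡⟨ solve (x ∷ t₁ ∷ t₂ ∷ N ∷ Y ∷ s ∷ p ∷ []) ⟩
          s * p * N + t₂ * N + (t₁ * N + x * Y)    ≤⟨ +-mono-≤ (+-monoˡ-≤ (t₂ * N) (*-monoˡ-≤ N (*-monoʳ-≤ s p≤q)))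
                                                               (≤-trans h₁ (*-monoˡ-≤ Y y≤y′)) ⟩
          s * q * N + t₂ * N + y′ * Y              ≡⟨ +-assoc (s * q * N) _ _ ⟩
          s * q * N + (t₂ * N + y′ * Y)            ≤⟨ +-monoʳ-≤ (s * q * N) h₂ ⟩
          s * q * N + (z * Y + k * (s * q * N))    ≡⟨ solve (z ∷ k ∷ N ∷ Y ∷ s ∷ q ∷ []) ⟩
          z * Y + suc k * (s * q * N)              ∎

    -- Any scale with `m < 2 ^ L` will do, because `weight L / 2 ^ L` stays below 4; `L = m` is the
    -- simplest choice.
    time≤mass : ∀ {T t} → Builds 0 (length S) T t → Ideal (λ _ → B) T → t ≤ 4 * K * total S
    time≤mass {T} {t} b ideal = *-cancelʳ-≤ t _ (2 ^ m) {{m^n≢0 2 m}} (begin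
      t * 2 ^ m             ≡⟨ +-identityʳ _ ⟨
      t * 2 ^ m + 0         ≤⟨ builds-time-mass m b ideal ≤-refl (subst (_< 2 ^ m) (sym all) (n<2^n m)) ⟩
      prefix (length S) * (K * weight m)  ≡⟨ cong (_* (K * weight m)) all ⟩
      m * (K * weight m)    ≤⟨ *-monoʳ-≤ m (*-monoʳ-≤ K (weight≤ m)) ⟩
      m * (K * (4 * 2 ^ m)) ≡⟨ rearrange m K (2 ^ m) ⟩
      4 * K * m * 2 ^ m     ∎)
      where
      m = total S
      all : prefix (length S) ≡ m
      all = cong total (take-all (length S) S ≤-refl)
      rearrange : ∀ m K N → m * (K * (4 * N)) ≡ 4 * K * m * N
      rearrange = solve-∀

-- Ideality and existence of runs with balanced thresholds

module BalancedRuns (c : Costs) (B : ℕ) (S : List Entry) where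
  open Construction c B (threshold B) S
  open Runs c B (threshold B) S

  mass-small : ∀ {lo hi T t m} → Builds lo hi T t → prefix hi * (B + 1) ≤ prefix lo * (B + 1) + m →
    mass T * (B + 1) ≤ m
  mass-small {lo} {hi} b P≤ rewrite mass-builds b | *-distribʳ-∸ (B + 1) (prefix hi) (prefix lo) =
    m≤n+o⇒m∸n≤o (prefix hi * (B + 1)) (prefix lo * (B + 1)) P≤

  -- The invariant on `lo` says that the first i representatives and the keys
  -- before them carry at least i * m / (B + 1) accesses.
  mutual
    builds-ideal : ∀ {lo hi T t} → Builds lo hi T t → Ideal (λ _ → B) T
    builds-ideal nil = nil
    builds-ideal (node l<h f)
      -- Before the first representative `i` is 0, and the invariant holds with equality.
      with small , ideals ← fills-ideal f (m+[n∸m]≡n (prefix-mono (<⇒≤ l<h))) ≤-refl = node small ideals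

    fills-ideal : ∀ {base m i lo hi k t} {reps : Vec Entry k} {children} →
      Fills base m (suc i) lo hi reps children t → base + m ≡ prefix hi →
      i * m + base * (B + 1) ≤ prefix lo * (B + 1) →
      VecAll.All (λ T → mass T * (B + 1) ≤ m) children × VecAll.All (Ideal (λ _ → B)) children
    fills-ideal {base} {m} {i} {lo} {hi} (stop {T = T} B<i⊎lo≡hi b) total inv =
      (small B<i⊎lo≡hi VecAll.∷ VecAll.[]) , (builds-ideal b VecAll.∷ VecAll.[])
      where
      small : B < suc i ⊎ lo ≡ hi → mass T * (B + 1) ≤ m
      small (inj₂ refl) rewrite mass-builds b | n∸n≡0 (prefix lo) = z≤n
      -- With all `B` representatives placed, the invariant leaves at most `m / (B + 1)` accesses.
      small (inj₁ (s≤s B≤i)) = mass-small b (begin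
        prefix hi * (B + 1)             ≡⟨ cong (_* (B + 1)) total ⟨
        (base + m) * (B + 1)            ≡⟨ solve (base ∷ m ∷ B ∷ []) ⟩
        B * m + base * (B + 1) + m      ≤⟨ +-monoˡ-≤ m (+-monoˡ-≤ _ (*-monoˡ-≤ m B≤i)) ⟩
        i * m + base * (B + 1) + m      ≤⟨ +-monoˡ-≤ m inv ⟩
        prefix lo * (B + 1) + m         ∎)
    fills-ideal {base} {m} {i} {lo} {hi} (pick {j = j} {T = T} _ _ s j<h _ b f) total inv =
      let smalls , ideals = fills-ideal f total reached
      in (small (search-below s) VecAll.∷ smalls) , (builds-ideal b VecAll.∷ ideals)
      where
      θ = threshold B m (suc i)

      reached : suc i * m + base * (B + 1) ≤ prefix (suc j) * (B + 1)
      reached with search-reaches s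
      ... | inj₁ refl = contradiction j<h (<-irrefl refl)
      ... | inj₂ x≤ = begin
        suc i * m + base * (B + 1)   ≤⟨ +-monoˡ-≤ _ (threshold-lower B m (suc i)) ⟩
        θ * (B + 1) + base * (B + 1) ≡⟨ +-comm (θ * (B + 1)) _ ⟩
        base * (B + 1) + θ * (B + 1) ≡⟨ *-distribʳ-+ (B + 1) base θ ⟨
        (base + θ) * (B + 1)         ≤⟨ *-monoˡ-≤ (B + 1) x≤ ⟩
        prefix (suc j) * (B + 1)     ∎

      small : j ≡ lo ⊎ prefix j < base + θ → mass T * (B + 1) ≤ m
      small (inj₁ refl) rewrite mass-builds b | n∸n≡0 (prefix lo) = z≤n
      -- Being below the target by at least one whole access gains `B + 1`, which outweighs the
      -- rounding excess of at most `B`.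
      small (inj₂ P<) = mass-small b (+-cancelʳ-≤ (B + 1) _ _ (begin
        prefix j * (B + 1) + (B + 1)                  ≡⟨ +-comm _ (B + 1) ⟩
        suc (prefix j) * (B + 1)                      ≤⟨ *-monoˡ-≤ (B + 1) P< ⟩
        (base + θ) * (B + 1)                          ≡⟨ *-distribʳ-+ (B + 1) base θ ⟩
        base * (B + 1) + θ * (B + 1)                  ≤⟨ +-monoʳ-≤ _ (threshold-upper B m (suc i)) ⟩
        base * (B + 1) + (suc i * m + B)              ≤⟨ n≤1+n _ ⟩
        suc (base * (B + 1) + (suc i * m + B))        ≡⟨ solve (base ∷ i ∷ m ∷ B ∷ []) ⟩
        i * m + base * (B + 1) + m + (B + 1)          ≤⟨ +-monoˡ-≤ _ (+-monoˡ-≤ m inv) ⟩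
        prefix lo * (B + 1) + m + (B + 1)             ∎))

  -- A search that ran off the end would leave `prefix hi`, which is `base + m`, below its target.
  search-finds : ∀ {base m i lo hi j p} → base + m ≡ prefix hi → i ≤ B → lo < hi →
    Search (base + threshold B m i) lo hi j p → j < hi
  search-finds {base} {m} {i} {hi = hi} total i≤B l<h s with m≤n⇒m<n∨m≡n (search-≤ s)
  ... | inj₁ j<h = j<h
  ... | inj₂ refl with search-below s
  ...   | inj₁ refl = l<h
  ...   | inj₂ P<   = contradiction (begin
    base + threshold B m i  ≤⟨ +-monoʳ-≤ base (threshold≤m B m i i≤B) ⟩
    base + m                ≡⟨ total ⟩
    prefix hi               ∎) (<⇒≱ P<)

  module _ (1≤B : 1 ≤ B) where
    mutual
      -- `fuel` bounds the number of keys in the range. Each pick removes one key, so both the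
      -- subtree before it and the remaining range fit into one unit less.
      builds-total : ∀ fuel {lo hi} → lo ≤ hi → hi ≤ length S → hi ≤ lo + fuel →
        ∃[ T ] ∃[ t ] Builds lo hi T t
      builds-total fuel {lo} lo≤hi hi≤n hi≤ with m≤n⇒m<n∨m≡n lo≤hi
      ... | inj₂ refl = _ , _ , nil
      builds-total zero {lo} lo≤hi hi≤n hi≤ | inj₁ l<h =
        contradiction (≤-trans hi≤ (≤-reflexive (+-identityʳ lo))) (<⇒≱ l<h)
      builds-total (suc fuel) lo≤hi hi≤n hi≤ | inj₁ l<h
        with _ , _ , _ , _ , f ← pick-total fuel (m+[n∸m]≡n (prefix-mono lo≤hi)) 1≤B l<h hi≤n hi≤ =
        _ , _ , node l<h f

      pick-total : ∀ fuel {base m i lo hi} → base + m ≡ prefix hi → i ≤ B → lo < hi →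
        hi ≤ length S → hi ≤ lo + suc fuel →
        ∃[ k ] Σ[ reps ∈ Vec Entry k ] ∃[ children ] ∃[ t ] Fills base m i lo hi reps children t
      pick-total fuel {base} {m} {i} {lo} {hi} total i≤B l<h hi≤n hi≤
        with j , p , s ← search-total (base + threshold B m i) (suc fuel) (<⇒≤ l<h) hi≤
        with j<h ← search-finds total i≤B l<h s
        with r , eq ← head-drop S (<-≤-trans j<h hi≤n)
        with T , t₁ , b ← builds-total fuel (search-≥ s) (≤-trans (<⇒≤ j<h) hi≤n)
                            (s≤s⁻¹ (≤-trans j<h (≤-trans hi≤ (≤-reflexive (+-suc lo fuel)))))
        with k , reps , children , t₂ , f ← fills-total fuel {i = suc i} total j<h hi≤n
                            (≤-trans hi≤ (≤-trans (≤-reflexive (+-suc lo fuel)) (s≤s (+-monoˡ-≤ fuel (search-≥ s)))))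
        = _ , _ , _ , _ , pick i≤B l<h s j<h eq b f

      fills-total : ∀ fuel {base m i lo hi} → base + m ≡ prefix hi → lo ≤ hi →
        hi ≤ length S → hi ≤ lo + fuel →
        ∃[ k ] Σ[ reps ∈ Vec Entry k ] ∃[ children ] ∃[ t ] Fills base m i lo hi reps children t
      fills-total fuel {i = i} total lo≤hi hi≤n hi≤ with m≤n⇒m<n∨m≡n lo≤hi | i ≤? B
      ... | inj₂ refl | _ = _ , _ , _ , _ , stop (inj₂ refl) nil
      ... | inj₁ l<h | no i≰B with _ , _ , b ← builds-total fuel lo≤hi hi≤n hi≤ =
        _ , _ , _ , _ , stop (inj₁ (≰⇒> i≰B)) b
      fills-total zero {lo = lo} total lo≤hi hi≤n hi≤ | inj₁ l<h | yes i≤B =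
        contradiction (≤-trans hi≤ (≤-reflexive (+-identityʳ lo))) (<⇒≱ l<h)
      fills-total (suc fuel) total lo≤hi hi≤n hi≤ | inj₁ l<h | yes i≤B =
        pick-total fuel total i≤B l<h hi≤n hi≤

-- Assembling the constants

-- From `n = 2` on the logarithm is at least 1 and absorbs the additive constants; at `n = 1` it
-- vanishes and the `1 ⊔` takes over.
n*[a+s*[1+l]]≤ : ∀ n a s → n * (a + s * suc ⌊log₂ n ⌋) ≤ (a + 2 * s) * (1 ⊔ n * ⌊log₂ n ⌋)
n*[a+s*[1+l]]≤ zero          a s = z≤n
n*[a+s*[1+l]]≤ (suc zero)    a s = begin
  1 * (a + s * 1)  ≤⟨ m≤m+n _ s ⟩
  1 * (a + s * 1) + s ≡⟨ solve (a ∷ s ∷ []) ⟩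
  (a + 2 * s) * 1  ∎
n*[a+s*[1+l]]≤ n@(suc (suc _)) a s = begin
  n * (a + s * suc l)    ≤⟨ *-monoʳ-≤ n (grow l (⌊log₂⌋-mono-≤ {2} {n} (s≤s (s≤s z≤n)))) ⟩
  n * ((a + 2 * s) * l)  ≡⟨ swap n (a + 2 * s) l ⟩
  (a + 2 * s) * (n * l)  ≤⟨ *-monoʳ-≤ (a + 2 * s) (m≤n⊔m 1 (n * l)) ⟩
  (a + 2 * s) * (1 ⊔ n * l) ∎
  where
  l = ⌊log₂ n ⌋
  swap : ∀ n x l → n * (x * l) ≡ x * (n * l)
  swap = solve-∀
  grow : ∀ l → 1 ≤ l → a + s * suc l ≤ (a + 2 * s) * l
  grow (suc l) _ = begin
    a + s * suc (suc l)                    ≤⟨ m≤m+n _ (a * l + s * l) ⟩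
    a + s * suc (suc l) + (a * l + s * l)  ≡⟨ solve (a ∷ s ∷ l ∷ []) ⟩
    (a + 2 * s) * suc l                    ∎

theorem7 : (B : ℕ) → 1 ≤ B →
    Σ[ θ ∈ (ℕ → ℕ → ℕ) ]
    ((c : Costs) →
     Σ[ C ∈ ℕ ]
     ((S : List Entry) → IsKeySet S →
      let n = length S
          m = total S
      in
      -- time; 1 ⊔_ only matters for n ≤ 1, where n log n = 0
      (Σ[ T ∈ Tree ] Σ[ t ∈ ℕ ]
        (Built c B θ S T t × IdealSABT B S T ×
         t ≤ C * (1 ⊔ ((n * ⌊log₂ n ⌋) ⊓ m))))
      ×
      -- memory and depth; the base of the logarithm is B except that log₁, which is undefined, is read as log₂
      ((T : Tree) → IdealSABT B S T →
        memory c B T ≤ C * n ×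
        depth T ≤ C * ⌊log[ 2 ⊔ B ] m ⌋)))
theorem7 B 1≤B = threshold B , λ c →
  let open Costs c
      K = nodeTime * B + B * probeTime
      -- `4 * K` covers both time bounds, `nodeMemory * B` the memory, and the 1 the depth.
      C = 4 * K + (nodeMemory * B + 1)
      4K≤C = m≤m+n (4 * K) (nodeMemory * B + 1)
  in C , λ S keySet →
  let open IsKeySet keySet
      open Runs c B (threshold B) S
      open BalancedRuns c B S
      n = length S
      m = total S
      T , t , b = builds-total 1≤B n z≤n ≤-refl ≤-refl
      ideal = builds-ideal b
      sabt = subst (λ xs → IsSABT B xs T) (take-all n S ≤-refl) (builds-SABT 1≤B b)
      t≤n*X = begin
        t                                                ≡⟨ +-identityʳ t ⟨
        t + 0                                            ≤⟨ builds-time-keys 1≤B (suc ⌊log₂ n ⌋) b (n<2^[1+⌊log₂n⌋] n) ⟩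
        n * (nodeTime * B + probeTime * suc ⌊log₂ n ⌋)   ∎
      t≤nlogn = begin
        t                                                            ≤⟨ t≤n*X ⟩
        n * (nodeTime * B + probeTime * suc ⌊log₂ n ⌋)               ≤⟨ n*[a+s*[1+l]]≤ n (nodeTime * B) probeTime ⟩
        (nodeTime * B + 2 * probeTime) * (1 ⊔ n * ⌊log₂ n ⌋)         ≤⟨ *-monoˡ-≤ _ (≤-trans (a+2s≤4K (nodeTime * B) probeTime) 4K≤C) ⟩
        C * (1 ⊔ n * ⌊log₂ n ⌋)                                      ∎
      t≤m = begin
        t            ≤⟨ time≤mass 1≤B positive b ideal ⟩
        4 * K * m    ≤⟨ *-mono-≤ 4K≤C (m≤n⊔m 1 m) ⟩
        C * (1 ⊔ m)  ∎
  in (T , t , b , (sabt , ideal) , ≤-min C (n * ⌊log₂ n ⌋) m t≤nlogn t≤m)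
   , λ T′ ideal′ →
     (begin
       nodes T′ * (nodeMemory * B)  ≤⟨ *-mono-≤ (nodes≤length (proj₁ ideal′)) (≤-trans (m≤m+n _ 1) (m≤n+m _ (4 * K))) ⟩
       n * C                        ≡⟨ *-comm n C ⟩
       C * n                        ∎)
   , (begin
       depth T′                  ≤⟨ depth≤log 1≤B positive ideal′ ⟩
       ⌊log[ 2 ⊔ B ] m ⌋         ≡⟨ *-identityˡ _ ⟨
       1 * ⌊log[ 2 ⊔ B ] m ⌋     ≤⟨ *-monoˡ-≤ _ (≤-trans (m≤n+m 1 (nodeMemory * B)) (m≤n+m _ (4 * K))) ⟩
       C * ⌊log[ 2 ⊔ B ] m ⌋     ∎)
  where
  a+2s≤4K : ∀ a s → a + 2 * s ≤ 4 * (a + B * s)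
  a+2s≤4K a s = begin
    a + 2 * s                              ≤⟨ m≤m+n _ (3 * a + 2 * s) ⟩
    a + 2 * s + (3 * a + 2 * s)            ≡⟨ solve (a ∷ s ∷ []) ⟩
    4 * (a + 1 * s)                        ≤⟨ *-monoʳ-≤ 4 (+-monoʳ-≤ a (*-monoˡ-≤ s 1≤B)) ⟩
    4 * (a + B * s)                        ∎

  ≤-min : ∀ C x y {t} → t ≤ C * (1 ⊔ x) → t ≤ C * (1 ⊔ y) → t ≤ C * (1 ⊔ (x ⊓ y))
  ≤-min C x y t≤x t≤y with ⊓-sel x y
  ... | inj₁ eq rewrite eq = t≤x
  ... | inj₂ eq rewrite eq = t≤y
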